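{- Let $\mathcal{B}$ be the (infinite) set of all full binary trees, and let $$H(x,q) := \sum_{T\in\mathcal{B}} x^{V(T)} q^{J(T)},$$ a formal power series in $x$ whose coefficients are polynomials in $q$. Then $$ H(x,q)=-\frac{ -q x +\sqrt{q^{2} x^{2}-2 q x^{2}-2 q x +x^{2}-2 x +1}+x -1}{2 q x}, $$ where the square root denotes the formal power series square root with constant term $1$ (the numerator is then divisible by $2qx$).
   Context: A full binary tree is an unlabeled ordered tree defined recursively: it is either the single-vertex tree, denoted $\cdot$, or a pair $T=[T_L,T_R]$ where $T_L$ (left subtree) and $T_R$ (right subtree) are full binary trees. The number of internal vertices $V(T)$ is defined by $V(\cdot)=0$, $V([T_L,T_R])=V(T_L)+V(T_R)+1$. The number of jumps $J(T)$ is defined by $J(\cdot)=0$ and $J([T_L,T_R])=J(T_R)$ if $T_L=\cdot$, while $J([T_L,T_R])=J(T_L)+J(T_R)+1$ if $T_L\neq \cdot$. -}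

module Defs where

open import Algebra.Bundles.Raw using (RawRing)
import Algebra.Definitions.RawMonoid as RawMonoidDefs
import Algebra.Definitions.RawSemiring as RawSemiringDefs
open import Data.Fin.Base using (toℕ)
import Data.Integer.Base as ℤ
open import Data.List.Base
  using (List; []; _∷_; map; foldr; filter; cartesianProductWith)
open import Data.List.Membership.Propositional using (_∈_)
open import Data.List.Membership.Propositional.Properties
  using (∈-cartesianProductWith⁺; ∈-cartesianProductWith⁻; ∈-filter⁺; ∈-filter⁻)
open import Data.List.Relation.Unary.All as All using (All)
open import Data.List.Relation.Unary.AllPairs using ([]; _∷_)
open import Data.List.Relation.Unary.Any using (here; there)
open import Data.List.Relation.Unary.Unique.Propositional using (Unique)
import Data.List.Relation.Unary.Unique.Propositional.Properties as Unique
open import Data.Nat.Base as ℕ using (ℕ; zero; suc; z≤n; s≤s; _≤_; _∸_)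
open import Data.Nat.Properties
  using (_≟_; ≤-trans; ≤-reflexive; m≤m+n; m≤n+m; +-comm)
open import Data.Product.Base using (_×_; _,_; proj₂)
open import Level using (_⊔_)
open import Relation.Binary.PropositionalEquality using (_≡_; _≢_; refl; subst)

------------------------------------------------------------------------
-- Full binary trees

data Tree : Set where
  leaf : Tree
  node : Tree → Tree → Tree

V : Tree → ℕ
V leaf       = 0
V (node l r) = V l ℕ.+ V r ℕ.+ 1

J : Tree → ℕ
J leaf                  = 0
J (node leaf r)         = J r
J (node l@(node _ _) r) = J l ℕ.+ J r ℕ.+ 1

-- All trees of height at most d; in particular all trees with at most d
-- internal vertices.
treesOfHeight≤ : ℕ → List Tree
treesOfHeight≤ zero    = leaf ∷ []
treesOfHeight≤ (suc d) =
  leaf ∷ cartesianProductWith node (treesOfHeight≤ d) (treesOfHeight≤ d)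

treesWithV : ℕ → List Tree
treesWithV n = filter (λ T → V T ≟ n) (treesOfHeight≤ n)

-- treesWithV n lists every tree with n internal vertices exactly once.

private
  V≤⇒∈ : ∀ d T → V T ≤ d → T ∈ treesOfHeight≤ d
  V≤⇒∈ zero    leaf       _  = here refl
  V≤⇒∈ (suc d) leaf       _  = here refl
  V≤⇒∈ zero    (node l r) p  with subst (_≤ 0) (+-comm (V l ℕ.+ V r) 1) p
  ... | ()
  V≤⇒∈ (suc d) (node l r) p  with subst (_≤ suc d) (+-comm (V l ℕ.+ V r) 1) p
  ... | s≤s p′ = there (∈-cartesianProductWith⁺ node
    (V≤⇒∈ d l (≤-trans (m≤m+n (V l) (V r)) p′))
    (V≤⇒∈ d r (≤-trans (m≤n+m (V r) (V l)) p′)))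

  node-injective : ∀ {l l′ r r′} → node l r ≡ node l′ r′ → l ≡ l′ × r ≡ r′
  node-injective refl = refl , refl

  treesOfHeight≤-unique : ∀ d → Unique (treesOfHeight≤ d)
  treesOfHeight≤-unique zero    = All.[] ∷ []
  treesOfHeight≤-unique (suc d) =
    All.tabulate leaf≢ ∷ Unique.cartesianProductWith⁺ node node-injective
      (treesOfHeight≤-unique d) (treesOfHeight≤-unique d)
    where
    ts = treesOfHeight≤ d
    leaf≢ : ∀ {T} → T ∈ cartesianProductWith node ts ts → leaf ≢ T
    leaf≢ T∈ refl with ∈-cartesianProductWith⁻ node ts ts T∈
    ... | _ , _ , _ , _ , ()

treesWithV-complete : ∀ T → T ∈ treesWithV (V T)
treesWithV-complete T =
  ∈-filter⁺ (λ T′ → V T′ ≟ V T) (V≤⇒∈ (V T) T (≤-reflexive refl)) refl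

treesWithV-sound : ∀ {n T} → T ∈ treesWithV n → V T ≡ n
treesWithV-sound {n} T∈ =
  proj₂ (∈-filter⁻ (λ T → V T ≟ n) {xs = treesOfHeight≤ n} T∈)

treesWithV-unique : ∀ n → Unique (treesWithV n)
treesWithV-unique n = Unique.filter⁺ (λ T → V T ≟ n) (treesOfHeight≤-unique n)

------------------------------------------------------------------------
-- Univariate polynomials: coefficient lists, constant term first, compared
-- coefficientwise so that trailing zeros are irrelevant.

module Polynomial {c ℓ} (R : RawRing c ℓ) where
  open RawRing R

  coeff : List Carrier → ℕ → Carrier
  coeff []      _       = 0#
  coeff (a ∷ _) zero    = a
  coeff (_ ∷ p) (suc k) = coeff p k

  infixl 6 _⊕_
  infixl 7 _⊛_

  _⊕_ : List Carrier → List Carrier → List Carrier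
  []      ⊕ p       = p
  (a ∷ p) ⊕ []      = a ∷ p
  (a ∷ p) ⊕ (b ∷ s) = a + b ∷ p ⊕ s

  _⊛_ : List Carrier → List Carrier → List Carrier
  []      ⊛ s = []
  (a ∷ p) ⊛ s = map (a *_) s ⊕ (0# ∷ p ⊛ s)

  rawRing : RawRing c ℓ
  rawRing = record
    { Carrier = List Carrier
    ; _≈_     = λ p s → ∀ k → coeff p k ≈ coeff s k
    ; _+_     = _⊕_
    ; _*_     = _⊛_
    ; -_      = map -_
    ; 0#      = []
    ; 1#      = 1# ∷ []
    }

  indeterminate : List Carrier
  indeterminate = 0# ∷ 1# ∷ []

------------------------------------------------------------------------
-- Univariate formal power series: f n is the coefficient of the n-th power.

module PowerSeries {c ℓ} (R : RawRing c ℓ) where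
  open RawRing R
  open RawMonoidDefs +-rawMonoid using (sum)

  constant : Carrier → (ℕ → Carrier)
  constant a zero    = a
  constant a (suc _) = 0#

  rawRing : RawRing c ℓ
  rawRing = record
    { Carrier = ℕ → Carrier
    ; _≈_     = λ f g → ∀ n → f n ≈ g n
    ; _+_     = λ f g n → f n + g n
    ; _*_     = λ f g n → sum {suc n} (λ i → f (toℕ i) * g (n ∸ toℕ i))
    ; -_      = λ f n → - f n
    ; 0#      = λ _ → 0#
    ; 1#      = constant 1#
    }

  indeterminate : ℕ → Carrier
  indeterminate 1 = 1#
  indeterminate _ = 0#

  private module S = RawRing rawRing

  record IsSquareRoot (D s : S.Carrier) : Set (c ⊔ ℓ) where
    field
      square       : s S.* s S.≈ D
      constantTerm : s 0 ≈ 1#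
      unique       : ∀ t → t S.* t S.≈ D → t 0 ≈ 1# → t S.≈ s

  record IsQuotient (num den h : S.Carrier) : Set (c ⊔ ℓ) where
    field
      divides : den S.* h S.≈ num
      unique  : ∀ g → den S.* g S.≈ num → g S.≈ h

------------------------------------------------------------------------
-- ℤ[q] and ℤ[q][[x]]

ℤ[q] : RawRing _ _
ℤ[q] = Polynomial.rawRing ℤ.+-*-rawRing

ℤ[q][[x]] : RawRing _ _
ℤ[q][[x]] = PowerSeries.rawRing ℤ[q]

open RawRing ℤ[q][[x]] public
  using (_≈_; _+_; _*_; -_; 1#) renaming (Carrier to Series)
open RawSemiringDefs (RawRing.rawSemiring ℤ[q][[x]]) public using (_^_)
open PowerSeries ℤ[q] public using (IsSquareRoot; IsQuotient)

infixl 6 _-_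
_-_ : Series → Series → Series
f - g = f + - g

2# : Series
2# = 1# + 1#

x : Series
x = PowerSeries.indeterminate ℤ[q]

q : Series
q = PowerSeries.constant ℤ[q] (Polynomial.indeterminate ℤ.+-*-rawRing)

-- The sum of x ^ V T * q ^ J T over all trees T: only the finitely many trees
-- with V T ≡ n contribute to the coefficient of x ^ n.
H : Series
H n = foldr P._+_ P.0# (map (λ T → indeterminate P^ J T) (treesWithV n))
  where
  module P = RawRing ℤ[q]
  open Polynomial ℤ.+-*-rawRing using (indeterminate)
  open RawSemiringDefs P.rawSemiring using () renaming (_^_ to _P^_)

{-# OPTIONS --safe #-}
-- Splitting a tree at its root gives H = 1 + x K H, where K = 1 + q (H - 1)
-- counts left subtrees with the extra jump they cause. Hence
-- s = 1 + (q - 1) x - 2 q x H satisfies s² = D, and -H is the quotient. Square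
-- roots with constant term 1 are unique because the sum of two of them has the
-- constant term 2, which is not a zero divisor, and 2 q x is not one either.
module Submission where

open import Defs using (module Polynomial; module PowerSeries)
open import Algebra.Bundles using (CommutativeRing; RawRing)
import Algebra.Construct.Pointwise as Pointwise
open import Algebra.Morphism.Structures using (module RingMorphisms)
import Algebra.Morphism.RingMonomorphism as RingMonomorphism
import Algebra.Properties.Ring as RingProperties
import Algebra.Properties.Semiring.Exp as Exp
import Algebra.Properties.Semiring.Sum as Sum
import Algebra.Solver.Ring.NaturalCoefficients.Default as SemiringSolver
open import Data.Fin.Base using (Fin; zero; suc; toℕ; fromℕ<)
open import Data.Fin.Properties using (toℕ-fromℕ<; toℕ-injective; toℕ≤pred[n])
import Data.Integer.Base as ℤ
import Data.Integer.Properties as ℤ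
open import Data.List.Base
  using (List; []; _∷_; _++_; map; foldr; concat; tabulate; cartesianProductWith)
open import Data.List.Membership.Propositional using (_∈_)
open import Data.List.Membership.Propositional.Properties
  using (∈-cartesianProductWith⁺; ∈-cartesianProductWith⁻; ∈-concat⁺′; ∈-concat⁻′;
         ∈-tabulate⁺; ∈-tabulate⁻)
open import Data.List.Membership.Propositional.Properties.WithK
  using (unique∧set⇒bag)
open import Data.List.Relation.Binary.BagAndSetEquality using (∼bag⇒↭)
open import Data.List.Relation.Binary.Permutation.Propositional
  using (_↭_; ↭⇒↭ₛ′)
import Data.List.Relation.Binary.Permutation.Propositional.Properties as ↭
import Data.List.Relation.Binary.Permutation.Setoid.Properties as ↭ₛ
import Data.List.Relation.Unary.All.Properties as All
import Data.List.Relation.Unary.AllPairs.Properties as AllPairs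
open import Data.List.Relation.Unary.Any using (here; there)
open import Data.List.Relation.Unary.Unique.Propositional using (Unique)
import Data.List.Relation.Unary.Unique.Propositional.Properties as Unique
open import Data.Nat.Base as ℕ using (ℕ; zero; suc; _∸_; s≤s)
open import Data.Nat.Properties as ℕ
  using (suc-injective; m≤m+n; m+n∸m≡n; m+[n∸m]≡n)
open import Data.Product using (_×_; ∃-syntax; _,_)
open import Function.Base using (_∘_; _$_)
open import Function.Bundles using (mk⇔)
open import Relation.Binary.PropositionalEquality as ≡ using (_≡_)
import Relation.Binary.Reasoning.Setoid as SetoidReasoning

-- Cancellable elements of a commutative ring.

module Regularity {c ℓ} (R : CommutativeRing c ℓ) where
  open CommutativeRing R

  Regular : Carrier → Set _
  Regular e = ∀ a b → a * e ≈ b * e → a ≈ b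

  Regular-resp-≈ : ∀ {e e′} → e ≈ e′ → Regular e → Regular e′
  Regular-resp-≈ e≈e′ reg a b eq =
    reg a b (trans (*-congˡ e≈e′) (trans eq (*-congˡ (sym e≈e′))))

  Regular-* : ∀ {e e′} → Regular e → Regular e′ → Regular (e * e′)
  Regular-* {e} {e′} reg reg′ a b eq =
    reg a b (reg′ _ _ (trans (*-assoc a e e′) (trans eq (sym (*-assoc b e e′)))))

  -- This is `t² - s² = (t - s)(t + s)` without subtraction: both `t * (t + s)` and `s * (t + s)`
  -- equal `s * s + s * t`, and `t + s` cancels.
  square-injective : ∀ s t → Regular (t + s) → t * t ≈ s * s → t ≈ s
  square-injective s t reg eq = reg t s $ begin
    t * (t + s)    ≈⟨ distribˡ t t s ⟩
    t * t + t * s  ≈⟨ +-cong eq (*-comm t s) ⟩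
    s * s + s * t  ≈⟨ +-comm _ _ ⟩
    s * t + s * s  ≈⟨ distribˡ s t s ⟨
    s * (t + s)    ∎
    where
    open SetoidReasoning setoid

-- Formal power series under convolution.

module PowerSeriesRing {c ℓ} (R : CommutativeRing c ℓ) where
  open CommutativeRing R
  open Sum semiring
  open Regularity R using (Regular)
  open RingProperties ring using (+-cancelˡ)
  open PowerSeries rawRing using (constant; indeterminate)
  open SetoidReasoning setoid
  private
    module S = RawRing (PowerSeries.rawRing rawRing)

  private
    term : S.Carrier → S.Carrier → ∀ n → Fin (suc n) → Carrier
    term f g n i = f (toℕ i) * g (n ∸ toℕ i)

  *-conv-cong : ∀ {f f′ g g′} → f S.≈ f′ → g S.≈ g′ → f S.* g S.≈ f′ S.* g′
  *-conv-cong f≈f′ g≈g′ n =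
    sum-cong-≋ {suc n} λ i → *-cong (f≈f′ (toℕ i)) (g≈g′ (n ∸ toℕ i))

  head-* : ∀ f g → (f S.* g) 0 ≈ f 0 * g 0
  head-* f g = +-identityʳ _

  zero-* : ∀ g → S.0# S.* g S.≈ S.0#
  zero-* g n = trans (sum-cong-≋ {suc n} λ i → zeroˡ (g (n ∸ toℕ i))) (sum-replicate-zero (suc n))

  constant-* : ∀ a f n → (constant a S.* f) n ≈ a * f n
  constant-* a f zero    = head-* (constant a) f
  constant-* a f (suc n) = trans (+-congˡ (zero-* f n)) (+-identityʳ _)

  scale-* : ∀ a f g n → ((λ k → a * f k) S.* g) n ≈ a * (f S.* g) n
  scale-* a f g n =
    trans (sum-cong-≋ {suc n} λ i → *-assoc a (f (toℕ i)) (g (n ∸ toℕ i)))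
      (sym (*-distribˡ-sum a (term f g n)))

  *-conv-distribʳ : ∀ h f g → (f S.+ g) S.* h S.≈ f S.* h S.+ g S.* h
  *-conv-distribʳ h f g n =
    trans (sum-cong-≋ {suc n} λ i →
        distribʳ (h (n ∸ toℕ i)) (f (toℕ i)) (g (toℕ i)))
      (∑-distrib-+ (term f h n) (term g h n))

  -- By computation a convolution splits off its first summand, the one with `f 0`. Splitting off
  -- the last one, with `g 0`, is the mirror image that commutativity needs.
  *-suc : ∀ f g n → (f S.* g) (suc n) ≈ f (suc n) * g 0 + (f S.* (g ∘ suc)) n
  *-suc f g zero    = begin
    f 0 * g 1 + (f 1 * g 0 + 0#)  ≈⟨ +-congˡ (+-identityʳ _) ⟩
    f 0 * g 1 + f 1 * g 0         ≈⟨ +-comm _ _ ⟩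
    f 1 * g 0 + f 0 * g 1         ≈⟨ +-congˡ (+-identityʳ _) ⟨
    f 1 * g 0 + (f 0 * g 1 + 0#)  ∎
  *-suc f g (suc n) = begin
    a + (f ∘ suc S.* g) (suc n)              ≈⟨ +-congˡ (*-suc (f ∘ suc) g n) ⟩
    a + (b + (f ∘ suc S.* g ∘ suc) n)        ≈⟨ +-assoc a b _ ⟨
    a + b + (f ∘ suc S.* g ∘ suc) n          ≈⟨ +-congʳ (+-comm a b) ⟩
    b + a + (f ∘ suc S.* g ∘ suc) n          ≈⟨ +-assoc b a _ ⟩
    b + (a + (f ∘ suc S.* g ∘ suc) n)        ∎
    where
    a = f 0 * g (suc (suc n))
    b = f (suc (suc n)) * g 0

  *-conv-comm : ∀ f g → f S.* g S.≈ g S.* f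
  *-conv-comm f g zero    = +-congʳ (*-comm (f 0) (g 0))
  *-conv-comm f g (suc n) = begin
    -- The induction runs over all `f` at once, because the hypothesis is applied to the tail of
    -- `f`.
    f 0 * g (suc n) + (f ∘ suc S.* g) n  ≈⟨ +-cong (*-comm _ _) (*-conv-comm (f ∘ suc) g n) ⟩
    g (suc n) * f 0 + (g S.* f ∘ suc) n  ≈⟨ *-suc g f n ⟨
    (g S.* f) (suc n)                    ∎

  *-conv-assoc : ∀ f g h → (f S.* g) S.* h S.≈ f S.* (g S.* h)
  *-conv-assoc f g h zero = begin
    (f S.* g S.* h) 0      ≈⟨ head-* (f S.* g) h ⟩
    (f S.* g) 0 * h 0      ≈⟨ *-congʳ (head-* f g) ⟩
    f 0 * g 0 * h 0        ≈⟨ *-assoc _ _ _ ⟩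
    f 0 * (g 0 * h 0)      ≈⟨ *-congˡ (head-* g h) ⟨
    f 0 * (g S.* h) 0      ≈⟨ head-* f (g S.* h) ⟨
    (f S.* (g S.* h)) 0    ∎
  *-conv-assoc f g h (suc n) = begin
    -- The tail of `f S.* g` computes to `f 0` times the tail of `g`, plus the tail of `f` convolved
    -- with `g`. The first part only needs scaling, the second is the induction hypothesis.
    (f S.* g) 0 * h (suc n) + ((f S.* g) ∘ suc S.* h) n
      ≈⟨ +-cong (trans (*-congʳ (head-* f g)) (*-assoc _ _ _))
           (*-conv-distribʳ h (λ k → f 0 * g (suc k)) (f ∘ suc S.* g) n) ⟩
    f 0 * (g 0 * h (suc n))
      + (((λ k → f 0 * g (suc k)) S.* h) n + (f ∘ suc S.* g S.* h) n)
      ≈⟨ +-congˡ (+-cong (scale-* (f 0) (g ∘ suc) h n) (*-conv-assoc (f ∘ suc) g h n)) ⟩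
    f 0 * (g 0 * h (suc n))
      + (f 0 * (g ∘ suc S.* h) n + (f ∘ suc S.* (g S.* h)) n)
      ≈⟨ +-assoc _ _ _ ⟨
    f 0 * (g 0 * h (suc n)) + f 0 * (g ∘ suc S.* h) n + (f ∘ suc S.* (g S.* h)) n
      ≈⟨ +-congʳ (distribˡ _ _ _) ⟨
    f 0 * (g S.* h) (suc n) + (f ∘ suc S.* (g S.* h)) n  ∎

  *-conv-identityˡ : ∀ f → S.1# S.* f S.≈ f
  *-conv-identityˡ f n = trans (constant-* 1# f n) (*-identityˡ (f n))

  commutativeRing : CommutativeRing _ _
  commutativeRing = record
    { Carrier = S.Carrier
    ; _≈_     = S._≈_
    ; _+_     = S._+_
    ; _*_     = S._*_
    ; -_      = S.-_
    ; 0#      = S.0#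
    ; 1#      = S.1#
    ; isCommutativeRing = record
      { isRing = record
        { +-isAbelianGroup =
            CommutativeRing.+-isAbelianGroup (Pointwise.commutativeRing ℕ R)
        ; *-cong     = *-conv-cong
        ; *-assoc    = *-conv-assoc
        ; *-identity = *-conv-identityˡ
          , λ f n → trans (*-conv-comm f S.1# n) (*-conv-identityˡ f n)
        ; distrib    =
            (λ h f g n → trans (*-conv-comm h (f S.+ g) n)
              (trans (*-conv-distribʳ h f g n)
                (+-cong (*-conv-comm f h n) (*-conv-comm g h n))))
          , *-conv-distribʳ
        }
      ; *-comm = *-conv-comm
      }
    }

  indeterminate-*-zero : ∀ f → (indeterminate S.* f) 0 ≈ 0#
  indeterminate-*-zero f = trans (head-* indeterminate f) (zeroˡ _)

  indeterminate-*-suc : ∀ f n → (indeterminate S.* f) (suc n) ≈ f n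
  indeterminate-*-suc f n = begin
    0# * f (suc n) + (indeterminate ∘ suc S.* f) n
      ≈⟨ +-cong (zeroˡ _) (*-conv-cong {g = f} tail≈1 (λ _ → refl) n) ⟩
    0# + (S.1# S.* f) n  ≈⟨ +-identityˡ _ ⟩
    (S.1# S.* f) n       ≈⟨ *-conv-identityˡ f n ⟩
    f n                  ∎
    where
    tail≈1 : indeterminate ∘ suc S.≈ S.1#
    tail≈1 zero    = refl
    tail≈1 (suc _) = refl

  module SR = Regularity commutativeRing

  -- Multiplication by the indeterminate shifts coefficients by one place, so coefficient `n` of a
  -- factor is read off at `suc n` in the product.
  indeterminate-regular : SR.Regular indeterminate
  indeterminate-regular f g eq n = begin
    f n                              ≈⟨ indeterminate-*-suc f n ⟨
    (indeterminate S.* f) (suc n)    ≈⟨ *-conv-comm indeterminate f (suc n) ⟩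
    (f S.* indeterminate) (suc n)    ≈⟨ eq (suc n) ⟩
    (g S.* indeterminate) (suc n)    ≈⟨ *-conv-comm g indeterminate (suc n) ⟩
    (indeterminate S.* g) (suc n)    ≈⟨ indeterminate-*-suc g n ⟩
    g n                              ∎

  -- Coefficients are cancelled one at a time. Position 0 gives `f 0 ≈ g 0`; removing the equal
  -- summands that contain these leaves the same equation for the tails.
  head-regular : ∀ e → Regular (e 0) → SR.Regular e
  head-regular e reg f g eq = λ where
      zero    → f₀≈g₀
      (suc n) → head-regular e reg (f ∘ suc) (g ∘ suc) tail-eq n
    where
    f₀≈g₀ : f 0 ≈ g 0
    f₀≈g₀ = reg (f 0) (g 0) (trans (sym (head-* f e)) (trans (eq 0) (head-* g e)))
    tail-eq : (f ∘ suc) S.* e S.≈ (g ∘ suc) S.* e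
    tail-eq n = +-cancelˡ (f 0 * e (suc n)) _ _
      (trans (eq (suc n)) (+-congʳ (*-congʳ (sym f₀≈g₀))))

-- Polynomials as a subring of the power series.

module PolynomialRing {c ℓ} (R : CommutativeRing c ℓ) where
  open CommutativeRing R
  open RingProperties ring using (-0#≈0#)
  open Polynomial rawRing using (coeff; _⊕_; _⊛_; indeterminate)
  open SetoidReasoning setoid
  private
    module P = RawRing (Polynomial.rawRing rawRing)
    module S = RawRing (PowerSeries.rawRing rawRing)
    module RS = PowerSeriesRing R
    module CS = CommutativeRing RS.commutativeRing

  coeff-⊕ : ∀ p s → coeff (p ⊕ s) S.≈ coeff p S.+ coeff s
  coeff-⊕ []      s       k       = sym (+-identityˡ _)
  coeff-⊕ (a ∷ p) []      k       = sym (+-identityʳ _)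
  coeff-⊕ (a ∷ p) (b ∷ s) zero    = refl
  coeff-⊕ (a ∷ p) (b ∷ s) (suc k) = coeff-⊕ p s k

  coeff-scale : ∀ a p k → coeff (map (a *_) p) k ≈ a * coeff p k
  coeff-scale a []      k       = sym (zeroʳ a)
  coeff-scale a (b ∷ p) zero    = refl
  coeff-scale a (b ∷ p) (suc k) = coeff-scale a p k

  coeff-neg : ∀ p → coeff (map -_ p) S.≈ S.- coeff p
  coeff-neg []      k       = sym -0#≈0#
  coeff-neg (a ∷ p) zero    = refl
  coeff-neg (a ∷ p) (suc k) = coeff-neg p k

  coeff-⊛ : ∀ p s → coeff (p ⊛ s) S.≈ coeff p S.* coeff s
  coeff-⊛ []      s k = sym (RS.zero-* (coeff s) k)
  coeff-⊛ (a ∷ p) s k = begin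
    coeff (map (a *_) s ⊕ (0# ∷ p ⊛ s)) k
      ≈⟨ coeff-⊕ (map (a *_) s) (0# ∷ p ⊛ s) k ⟩
    coeff (map (a *_) s) k + coeff (0# ∷ p ⊛ s) k
      ≈⟨ +-congʳ (coeff-scale a s k) ⟩
    a * coeff s k + coeff (0# ∷ p ⊛ s) k
      ≈⟨ split k ⟩
    (coeff (a ∷ p) S.* coeff s) k  ∎
    where
    split : ∀ k → a * coeff s k + coeff (0# ∷ p ⊛ s) k ≈ (coeff (a ∷ p) S.* coeff s) k
    split zero    = refl
    split (suc k) = +-congˡ (coeff-⊛ p s k)

  coeff-1 : coeff P.1# S.≈ S.1#
  coeff-1 zero    = refl
  coeff-1 (suc _) = refl

  -- Polynomials are compared by their coefficients, so injectivity is immediate, and all ring laws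
  -- for coefficient lists can be pulled back from power series.
  coeff-isRingMonomorphism :
    RingMorphisms.IsRingMonomorphism (Polynomial.rawRing rawRing)
      (PowerSeries.rawRing rawRing) coeff
  coeff-isRingMonomorphism = record
    { isRingHomomorphism = record
      { isSemiringHomomorphism = record
        { isNearSemiringHomomorphism = record
          { +-isMonoidHomomorphism = record
            { isMagmaHomomorphism = record
              { isRelHomomorphism = record { cong = λ eq → eq }
              ; homo = coeff-⊕
              }
            ; ε-homo = λ _ → refl
            }
          ; *-homo = coeff-⊛
          }
        ; 1#-homo = coeff-1
        }
      ; -‿homo = coeff-neg
      }
    ; injective = λ eq → eq
    }

  commutativeRing : CommutativeRing _ _
  commutativeRing = record
    { Carrier = P.Carrier
    ; _≈_     = P._≈_
    ; _+_     = P._+_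
    ; _*_     = P._*_
    ; -_      = P.-_
    ; 0#      = P.0#
    ; 1#      = P.1#
    ; isCommutativeRing = RingMonomorphism.isCommutativeRing
        coeff-isRingMonomorphism CS.isCommutativeRing
    }

  module PR = Regularity commutativeRing

  coeff-regular : ∀ p → RS.SR.Regular (coeff p) → PR.Regular p
  coeff-regular p reg a b eq = reg (coeff a) (coeff b) λ k →
    trans (sym (coeff-⊛ a p k)) (trans (eq k) (coeff-⊛ b p k))

  indeterminate-regular : PR.Regular indeterminate
  indeterminate-regular = coeff-regular indeterminate
    (RS.SR.Regular-resp-≈ coeff-X RS.indeterminate-regular)
    where
    coeff-X : PowerSeries.indeterminate rawRing S.≈ coeff indeterminate
    coeff-X zero          = refl
    coeff-X (suc zero)    = refl
    coeff-X (suc (suc _)) = refl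

-- The quadratic equation and its discriminant.

module QuadraticEquation {c ℓ} (R : CommutativeRing c ℓ) where
  open CommutativeRing R
  open Exp semiring using (_^_)
  open Regularity R using (Regular; square-injective)
  open RingProperties ring using (+-cancelʳ; -‿involutive)
  open SetoidReasoning setoid
  open SemiringSolver commutativeSemiring using (solve; con; _:+_; _:*_; _:^_; _:=_)

  module Solution (q x h k : Carrier)
    (k≈ : k ≈ 1# + q * (h - 1#)) (h≈ : h ≈ 1# + x * (k * h)) where

    -- `N` is a root of `q x N² + b N + 1`. Its discriminant `b² - 4 q x` is `D` in expanded form,
    -- and `s` is `b + 2 q x N`, the derivative of the quadratic at the root.
    2′ N b s D : Carrier
    2′ = 1# + 1#
    N  = - h
    b  = 1# + x * (q - 1#)
    s  = 1# + x * (q - 1# + 2′ * q * N)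
    D  = q ^ 2 * x ^ 2 - 2′ * q * x ^ 2 - 2′ * q * x + x ^ 2 - 2′ * x + 1#

    private
      -- The solver knows no negation: a negated term is passed to it as an
      -- independent variable, and the multiples of "term plus negated term" that
      -- an identity consumes are added explicitly and removed by these lemmas.
      kill : ∀ c {z} → z ≈ 0# → c * z ≈ 0#
      kill c z≈0 = trans (*-congˡ z≈0) (zeroʳ c)

      infixl 6 _∔_
      _∔_ : ∀ {a b} → a ≈ 0# → b ≈ 0# → a + b ≈ 0#
      a≈0 ∔ b≈0 = trans (+-cong a≈0 b≈0) (+-identityʳ 0#)

      drop : ∀ {a b z w} → z ≈ 0# → w ≈ 0# → a + z ≈ b + w → a ≈ b
      drop z≈0 w≈0 eq = trans (sym (trans (+-congˡ z≈0) (+-identityʳ _)))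
        (trans eq (trans (+-congˡ w≈0) (+-identityʳ _)))

      1-1≈0 : 1# - 1# ≈ 0#
      1-1≈0 = -‿inverseʳ 1#

      h+N≈0 : h + N ≈ 0#
      h+N≈0 = -‿inverseʳ h

    -- Eliminating `k` gives `h = 1 + x (1 + q (h - 1)) h`. Collecting powers of `h` and putting
    -- `h = - N` yields the quadratic.
    quadratic : q * x * (N * N) + b * N + 1# ≈ 0#
    quadratic = trans
      (drop (kill (q * x * h) h+N≈0 ∔ kill x h+N≈0 ∔ kill (q * x * h) 1-1≈0)
        (kill (q * x * N) h+N≈0 ∔ kill (x * N) 1-1≈0 ∔ kill (q * x) h+N≈0)
        (solve 5 (λ Q X H n e →
          Q :* X :* (n :* n) :+ (con 1 :+ X :* (Q :+ e)) :* n :+ con 1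
            :+ (Q :* X :* H :* (H :+ n) :+ X :* (H :+ n) :+ Q :* X :* H :* (con 1 :+ e))
          := con 1 :+ X :* ((con 1 :+ Q :* (H :+ e)) :* H) :+ n
            :+ (Q :* X :* n :* (H :+ n) :+ X :* n :* (con 1 :+ e) :+ Q :* X :* (H :+ n)))
          refl q x h N (- 1#)))
      -- What remains is `1 + x k h + N` with `k` expanded; the two hypotheses fold it to `h + N`.
      (trans (+-congʳ (sym (trans h≈ (+-congˡ (*-congˡ (*-congʳ k≈)))))) h+N≈0)

    private
      -- Completing the square: `(b + 2 q x N)² + 4 q x` exceeds `b²` by `4 q x` times the
      -- quadratic. Having `4 q x` on the left avoids a subtraction.
      s²+4qx≈b² : s * s + 2′ * 2′ * (q * x) ≈ b * b
      s²+4qx≈b² = begin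
        s * s + 2′ * 2′ * (q * x)
          ≈⟨ solve 4 (λ Q X n e →
               let two = con 1 :+ con 1
                   B = con 1 :+ X :* (Q :+ e)
                   S = con 1 :+ X :* (Q :+ e :+ two :* Q :* n)
               in S :* S :+ two :* two :* (Q :* X)
                 := B :* B :+ two :* two :* (Q :* X)
                      :* (Q :* X :* (n :* n) :+ B :* n :+ con 1))
               refl q x N (- 1#) ⟩
        b * b + 2′ * 2′ * (q * x) * (q * x * (N * N) + b * N + 1#)
          ≈⟨ +-congˡ (kill _ quadratic) ⟩
        b * b + 0#
          ≈⟨ +-identityʳ _ ⟩
        b * b  ∎

      D+4qx≈b² : D + 2′ * 2′ * (q * x) ≈ b * b
      D+4qx≈b² = drop
        -- These multiples of `1 - 1` supply, on the side of `D`, the terms of `b * b` that contain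
        -- a factor `- 1#`.
        (kill (2′ * q * x * x + 2′ * x + x * - 1# * x) 1-1≈0)
        (-‿inverseʳ (2′ * q * x ^ 2) ∔ -‿inverseʳ (2′ * q * x)
          ∔ -‿inverseʳ (2′ * x) ∔ kill (x * x) 1-1≈0)
        (solve 6 (λ Q X e m₁ m₂ m₃ →
          let two = con 1 :+ con 1
              B = con 1 :+ X :* (Q :+ e)
          in Q :^ 2 :* X :^ 2 :+ m₁ :+ m₂ :+ X :^ 2 :+ m₃ :+ con 1
               :+ two :* two :* (Q :* X)
               :+ (two :* Q :* X :* X :+ two :* X :+ X :* e :* X) :* (con 1 :+ e)
             := B :* B
               :+ (two :* Q :* X :^ 2 :+ m₁ :+ (two :* Q :* X :+ m₂)
                 :+ (two :* X :+ m₃) :+ X :* X :* (con 1 :+ e)))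
          refl q x (- 1#) (- (2′ * q * x ^ 2)) (- (2′ * q * x)) (- (2′ * x)))

    s²≈D : s * s ≈ D
    s²≈D = +-cancelʳ (2′ * 2′ * (q * x)) _ _ (trans s²+4qx≈b² (sym D+4qx≈b²))

    -- Since `s = 1 + q x - x + 2 q x N`, everything in the numerator except `2 q x N` cancels.
    denominator*N≈numerator : 2′ * q * x * N ≈ - q * x + s + x - 1#
    -- No correction is added on the left, so `drop` gets `refl` there and the solver sees `con 0`.
    denominator*N≈numerator = sym $ drop refl
      (kill x (-‿inverseʳ q) ∔ kill (x + 1#) 1-1≈0)
      (solve 5 (λ Q X n e m →
        let two = con 1 :+ con 1
        in m :* X :+ (con 1 :+ X :* (Q :+ e :+ two :* Q :* n)) :+ X :+ e :+ con 0
          := two :* Q :* X :* n :+ (X :* (Q :+ m) :+ (X :+ con 1) :* (con 1 :+ e)))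
        refl q x N (- 1#) (- q))

    square-root-unique : ∀ t → Regular (t + s) → t * t ≈ D → t ≈ s
    square-root-unique t reg t²≈D = square-injective s t reg (trans t²≈D (sym s²≈D))

    quotient-unique : Regular (2′ * q * x) →
      ∀ g → 2′ * q * x * g ≈ - q * x + s + x - 1# → g ≈ N
    quotient-unique reg g eq = reg g N $ begin
      g * (2′ * q * x)         ≈⟨ *-comm _ _ ⟩
      2′ * q * x * g           ≈⟨ eq ⟩
      - q * x + s + x - 1#     ≈⟨ denominator*N≈numerator ⟨
      2′ * q * x * N           ≈⟨ *-comm _ _ ⟩
      N * (2′ * q * x)         ∎

    h≈-N : h ≈ - N
    h≈-N = sym (-‿involutive h)

-- Weighted sums over finite lists.

module WeightedSum {c ℓ} (R : CommutativeRing c ℓ) where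
  open CommutativeRing R hiding (zero)
  open Sum semiring using (sum)
  open SetoidReasoning setoid

  wsum : ∀ {A : Set} → (A → Carrier) → List A → Carrier
  wsum w ts = foldr _+_ 0# (map w ts)

  module _ {A : Set} where

    wsum-cong : ∀ {u w : A → Carrier} ts → (∀ {t} → t ∈ ts → u t ≈ w t) →
                wsum u ts ≈ wsum w ts
    wsum-cong []       _  = refl
    wsum-cong (t ∷ ts) eq = +-cong (eq (here ≡.refl)) (wsum-cong ts (eq ∘ there))

    wsum-scale : ∀ a (w : A → Carrier) ts → wsum (λ t → a * w t) ts ≈ a * wsum w ts
    wsum-scale a w []       = sym (zeroʳ a)
    wsum-scale a w (t ∷ ts) =
      trans (+-congˡ (wsum-scale a w ts)) (sym (distribˡ a (w t) (wsum w ts)))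

    wsum-++ : ∀ (w : A → Carrier) ss ts → wsum w (ss ++ ts) ≈ wsum w ss + wsum w ts
    wsum-++ w []       ts = sym (+-identityˡ _)
    wsum-++ w (s ∷ ss) ts =
      trans (+-congˡ (wsum-++ w ss ts)) (sym (+-assoc (w s) _ _))

    wsum-concat : ∀ (w : A → Carrier) {n} (f : Fin n → List A) →
                  wsum w (concat (tabulate f)) ≈ sum (λ i → wsum w (f i))
    wsum-concat w {zero}  f = refl
    wsum-concat w {suc n} f =
      trans (wsum-++ w (f zero) _) (+-congˡ (wsum-concat w (f ∘ suc)))

    wsum-↭ : ∀ (w : A → Carrier) {ss ts} → ss ↭ ts → wsum w ss ≈ wsum w ts
    wsum-↭ w ss↭ts = ↭ₛ.foldr-commMonoid setoid +-isCommutativeMonoid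
      (↭⇒↭ₛ′ isEquivalence (↭.map⁺ w ss↭ts))

  module _ {A B : Set} where

    wsum-map : ∀ (w : A → Carrier) (f : B → A) ts →
               wsum w (map f ts) ≈ wsum (w ∘ f) ts
    wsum-map w f []       = refl
    wsum-map w f (t ∷ ts) = +-congˡ (wsum-map w f ts)

  module _ {A B C : Set} {w : A → Carrier} {u : B → Carrier} {v : C → Carrier} where

    -- A weight that is multiplicative along `f` turns the double sum into a product by
    -- distributivity. Applied to `node`, this produces the summands of a convolution.
    wsum-product : ∀ (f : B → C → A) →
      (∀ b c → w (f b c) ≈ u b * v c) → ∀ bs cs →
      wsum w (cartesianProductWith f bs cs) ≈ wsum u bs * wsum v cs
    wsum-product f eq [] cs = sym (zeroˡ _)
    wsum-product f eq (b ∷ bs) cs = begin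
      wsum w (map (f b) cs ++ cartesianProductWith f bs cs)
        ≈⟨ wsum-++ w (map (f b) cs) _ ⟩
      wsum w (map (f b) cs) + wsum w (cartesianProductWith f bs cs)
        ≈⟨ +-cong (wsum-map w (f b) cs) (wsum-product f eq bs cs) ⟩
      wsum (w ∘ f b) cs + wsum u bs * wsum v cs
        ≈⟨ +-congʳ (wsum-cong cs λ {c} _ → eq b c) ⟩
      wsum (λ c → u b * v c) cs + wsum u bs * wsum v cs
        ≈⟨ +-congʳ (wsum-scale (u b) v cs) ⟩
      u b * wsum v cs + wsum u bs * wsum v cs
        ≈⟨ distribʳ _ _ _ ⟨
      (u b + wsum u bs) * wsum v cs  ∎

-- Decomposition of trees at the root.

open import Defs
  using (Tree; leaf; node; V; J; treesWithV; treesWithV-sound;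
         treesWithV-complete; treesWithV-unique)

node-injective : ∀ {l l′ r r′} → node l r ≡ node l′ r′ → l ≡ l′ × r ≡ r′
node-injective ≡.refl = ≡.refl , ≡.refl

V-node : ∀ l r → V (node l r) ≡ suc (V l ℕ.+ V r)
V-node l r = ℕ.+-comm (V l ℕ.+ V r) 1

-- The root takes one of `suc n` internal vertices, leaving `n` to distribute. Indexing by the size
-- of the left subtree matches the summation index of a convolution.
rootSplits : ∀ n → Fin (suc n) → List Tree
rootSplits n i =
  cartesianProductWith node (treesWithV (toℕ i)) (treesWithV (n ∸ toℕ i))

∈-rootSplits⁻ : ∀ n i {T} → T ∈ rootSplits n i →
  ∃[ l ] ∃[ r ] (T ≡ node l r × V l ≡ toℕ i × V r ≡ n ∸ toℕ i)
∈-rootSplits⁻ n i T∈ =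
  let l , r , l∈ , r∈ , T≡ = ∈-cartesianProductWith⁻ node _ _ T∈
  in  l , r , T≡ , treesWithV-sound l∈ , treesWithV-sound r∈

allRootSplits : ℕ → List Tree
allRootSplits n = concat (tabulate (rootSplits n))

-- Inside a block `node` is injective, and distinct blocks are disjoint because a tree determines
-- its block through the size of its left subtree.
allRootSplits-unique : ∀ n → Unique (allRootSplits n)
allRootSplits-unique n = Unique.concat⁺
  (All.tabulate⁺ λ i → Unique.cartesianProductWith⁺ node node-injective
    (treesWithV-unique (toℕ i)) (treesWithV-unique (n ∸ toℕ i)))
  (AllPairs.tabulate⁺ λ {i} {j} i≢j (T∈i , T∈j) → i≢j (toℕ-injective (same i j T∈i T∈j)))
  where
  same : ∀ i j {T} → T ∈ rootSplits n i → T ∈ rootSplits n j → toℕ i ≡ toℕ j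
  same i j T∈i T∈j with ∈-rootSplits⁻ n i T∈i | ∈-rootSplits⁻ n j T∈j
  ... | _ , _ , ≡.refl , Vl≡i , _ | _ , _ , ≡.refl , Vl≡j , _ = ≡.trans (≡.sym Vl≡i) Vl≡j

allRootSplits-sound : ∀ n {T} → T ∈ allRootSplits n → T ∈ treesWithV (suc n)
allRootSplits-sound n T∈ with ∈-concat⁻′ (tabulate (rootSplits n)) T∈
... | _ , T∈i , i∈ with ∈-tabulate⁻ {f = rootSplits n} i∈
... | i , ≡.refl with ∈-rootSplits⁻ n i T∈i
... | l , r , ≡.refl , Vl≡ , Vr≡ =
  ≡.subst (λ m → node l r ∈ treesWithV m)
    (≡.trans (V-node l r) (≡.cong suc
      (≡.trans (≡.cong₂ ℕ._+_ Vl≡ Vr≡) (m+[n∸m]≡n (toℕ≤pred[n] i)))))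
    (treesWithV-complete (node l r))

allRootSplits-complete : ∀ n {T} → T ∈ treesWithV (suc n) → T ∈ allRootSplits n
allRootSplits-complete n {leaf} T∈ with treesWithV-sound {suc n} T∈
... | ()
allRootSplits-complete n {node l r} T∈ =
  ∈-concat⁺′ {xss = tabulate (rootSplits n)}
    (∈-cartesianProductWith⁺ node
      (≡.subst (λ m → l ∈ treesWithV m) (≡.sym toℕ-i) (treesWithV-complete l))
      (≡.subst (λ m → r ∈ treesWithV m) (≡.sym n∸i) (treesWithV-complete r)))
    (∈-tabulate⁺ {f = rootSplits n} i)
  where
  Vl+Vr≡n : V l ℕ.+ V r ≡ n
  Vl+Vr≡n = suc-injective
    (≡.trans (≡.sym (V-node l r)) (treesWithV-sound {suc n} T∈))
  Vl<1+n : V l ℕ.< suc n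
  Vl<1+n = s≤s (≡.subst (V l ℕ.≤_) Vl+Vr≡n (m≤m+n (V l) (V r)))
  i : Fin (suc n)
  i = fromℕ< Vl<1+n
  toℕ-i : toℕ i ≡ V l
  toℕ-i = toℕ-fromℕ< Vl<1+n
  n∸i : n ∸ toℕ i ≡ V r
  n∸i = ≡.trans (≡.cong₂ _∸_ (≡.sym Vl+Vr≡n) toℕ-i) (m+n∸m≡n (V l) (V r))

-- Two duplicate-free lists with the same members are permutations of each other; their orders are
-- irrelevant to a sum.
treesWithV-suc : ∀ n → treesWithV (suc n) ↭ allRootSplits n
treesWithV-suc n = ∼bag⇒↭ (unique∧set⇒bag (treesWithV-unique (suc n))
  (allRootSplits-unique n)
  (mk⇔ (allRootSplits-complete n) (allRootSplits-sound n)))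

-- The generating series by jumps and its closed form.

module JumpSeries {c ℓ} (R : CommutativeRing c ℓ) where
  open CommutativeRing R
  private
    module PS = PowerSeriesRing R
    module S = CommutativeRing PS.commutativeRing
    module SR = Regularity PS.commutativeRing
    open WeightedSum R
    open Exp semiring using (_^_; ^-homo-*)
    open Sum semiring using (sum; sum-cong-≋)
    open PowerSeries rawRing
    open SetoidReasoning setoid

  module _ (u : Carrier) (2-regular : Regularity.Regular R (1# + 1#))
    (u-regular : Regularity.Regular R u) where

    -- `leftWeight` charges a left subtree for the jump it causes at its parent. This makes the
    -- weight of a node a product over its two subtrees, whereas `jumpWeight` alone is not
    -- multiplicative.
    jumpWeight leftWeight : Tree → Carrier
    jumpWeight T = u ^ J T
    leftWeight leaf         = 1#
    leftWeight T@(node _ _) = u * jumpWeight T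

    jumpWeight-node : ∀ l r → jumpWeight (node l r) ≈ leftWeight l * jumpWeight r
    jumpWeight-node leaf           r = sym (*-identityˡ (jumpWeight r))
    jumpWeight-node l@(node _ _) r = begin
      u ^ (J l ℕ.+ J r ℕ.+ 1)            ≡⟨ ≡.cong (u ^_) (ℕ.+-comm (J l ℕ.+ J r) 1) ⟩
      u * u ^ (J l ℕ.+ J r)              ≈⟨ *-congˡ (^-homo-* u (J l) (J r)) ⟩
      u * (jumpWeight l * jumpWeight r)  ≈⟨ *-assoc _ _ _ ⟨
      u * jumpWeight l * jumpWeight r    ∎

    x q H K : S.Carrier
    x   = indeterminate
    q   = constant u
    H n = wsum jumpWeight (treesWithV n)
    K n = wsum leftWeight (treesWithV n)

    H-suc : ∀ n → H (suc n) ≈ (K S.* H) n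
    H-suc n = begin
      wsum jumpWeight (treesWithV (suc n))
        ≈⟨ wsum-↭ jumpWeight (treesWithV-suc n) ⟩
      wsum jumpWeight (allRootSplits n)
        ≈⟨ wsum-concat jumpWeight (rootSplits n) ⟩
      sum (λ i → wsum jumpWeight (rootSplits n i))
        ≈⟨ sum-cong-≋ {suc n} {λ i → wsum jumpWeight (rootSplits n i)}
             {λ i → K (toℕ i) * H (n ∸ toℕ i)}
             (λ i → wsum-product node jumpWeight-node
               (treesWithV (toℕ i)) (treesWithV (n ∸ toℕ i))) ⟩
      (K S.* H) n  ∎

    -- The two weights differ by the factor `u` except on `leaf`, which occurs only in degree 0.
    K-suc : ∀ n → K (suc n) ≈ u * H (suc n)
    K-suc n = trans (wsum-cong (treesWithV (suc n)) leftWeight-suc)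
        (wsum-scale u jumpWeight (treesWithV (suc n)))
      where
      leftWeight-suc : ∀ {T} → T ∈ treesWithV (suc n) → leftWeight T ≈ u * jumpWeight T
      leftWeight-suc {leaf} T∈ with treesWithV-sound {suc n} T∈
      ... | ()
      leftWeight-suc {node _ _} _ = refl

    H≈1+xKH : H S.≈ S.1# S.+ x S.* (K S.* H)
    -- `leaf` is the only tree in degree 0, so `H 0` computes to `1# + 0#`.
    H≈1+xKH zero    = +-congˡ (sym (PS.indeterminate-*-zero (K S.* H)))
    H≈1+xKH (suc n) = trans (H-suc n)
      (sym (trans (+-identityˡ _) (PS.indeterminate-*-suc (K S.* H) n)))

    K≈1+q[H-1] : K S.≈ S.1# S.+ q S.* (H S.- S.1#)
    K≈1+q[H-1] zero    = +-congˡ $ sym $ begin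
      (q S.* (H S.- S.1#)) 0  ≈⟨ PS.constant-* u (H S.- S.1#) 0 ⟩
      u * (1# + 0# - 1#)      ≈⟨ *-congˡ (+-congʳ (+-identityʳ 1#)) ⟩
      u * (1# - 1#)           ≈⟨ *-congˡ (-‿inverseʳ 1#) ⟩
      u * 0#                  ≈⟨ zeroʳ u ⟩
      0#                      ∎
    K≈1+q[H-1] (suc n) = begin
      K (suc n)                           ≈⟨ K-suc n ⟩
      u * H (suc n)                       ≈⟨ *-congˡ (+-identityʳ (H (suc n))) ⟨
      u * (H (suc n) + 0#)                ≈⟨ *-congˡ (+-congˡ -0#≈0#) ⟨
      u * (H S.- S.1#) (suc n)            ≈⟨ PS.constant-* u (H S.- S.1#) (suc n) ⟨
      (q S.* (H S.- S.1#)) (suc n)        ≈⟨ +-identityˡ _ ⟨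
      0# + (q S.* (H S.- S.1#)) (suc n)   ∎
      where open RingProperties ring using (-0#≈0#)

    open QuadraticEquation.Solution PS.commutativeRing q x H K K≈1+q[H-1] H≈1+xKH
      using (2′; N; s; D; s²≈D; denominator*N≈numerator; square-root-unique;
             quotient-unique; h≈-N)

    s₀≈1 : s 0 ≈ 1#
    s₀≈1 = trans (+-congˡ (PS.indeterminate-*-zero (q S.- S.1# S.+ 2′ S.* q S.* N)))
      (+-identityʳ 1#)

    -- The factors `2′` and `q` have the regular constant terms 2 and `u`; `x` has constant term 0
    -- and cancels by the shift argument instead.
    2qx-regular : SR.Regular (2′ S.* q S.* x)
    2qx-regular = SR.Regular-* {2′ S.* q} {x}
      (SR.Regular-* {2′} {q} (PS.head-regular 2′ 2-regular) (PS.head-regular q u-regular))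
      PS.indeterminate-regular

    isSquareRoot : IsSquareRoot D s
    isSquareRoot = record
      { square       = s²≈D
      ; constantTerm = s₀≈1
      ; unique       = λ t t²≈D t₀≈1 → square-root-unique t
          -- Both roots have constant term 1, so `t S.+ s` has constant term 2, which is regular.
          (PS.head-regular (t S.+ s)
            (Regularity.Regular-resp-≈ R (sym (+-cong t₀≈1 s₀≈1)) 2-regular))
          t²≈D
      }

    isQuotient : IsQuotient (S.- q S.* x S.+ s S.+ x S.- S.1#) (2′ S.* q S.* x) N
    isQuotient = record
      { divides = denominator*N≈numerator
      ; unique  = quotient-unique 2qx-regular
      }

    closedForm : ∃[ √D ] ∃[ Q ]
      ( IsSquareRoot D √D
      × IsQuotient (S.- q S.* x S.+ √D S.+ x S.- S.1#) (2′ S.* q S.* x) Q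
      × H S.≈ S.- Q )
    closedForm = s , N , isSquareRoot , isQuotient , h≈-N

-- Specialisation to integer polynomials.

module ℤ[q]-Ring = PolynomialRing ℤ.+-*-commutativeRing

-- Viewed as a power series, the constant polynomial 2 has constant term 2, which cancels in the
-- integers.
2-regular : ℤ[q]-Ring.PR.Regular (ℤ.1ℤ ℤ.+ ℤ.1ℤ ∷ [])
2-regular = ℤ[q]-Ring.coeff-regular (ℤ.1ℤ ℤ.+ ℤ.1ℤ ∷ [])
  (PowerSeriesRing.head-regular ℤ.+-*-commutativeRing _
    λ a b → ℤ.*-cancelʳ-≡ a b (ℤ.+ 2))

open import Defs

theorem3 : ∃[ √D ] ∃[ Q ]
    ( IsSquareRoot
    (q ^ 2 * x ^ 2 - 2# * q * x ^ 2 - 2# * q * x + x ^ 2 - 2# * x + 1#)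
    √D
    × IsQuotient (- q * x + √D + x - 1#) (2# * q * x) Q
    × H ≈ - Q )
-- With the polynomial indeterminate for `u`, the general `H`, `x`, `q` and `D` agree by computation
-- with the series in the statement.
theorem3 = JumpSeries.closedForm ℤ[q]-Ring.commutativeRing
  (Polynomial.indeterminate ℤ.+-*-rawRing) 2-regular ℤ[q]-Ring.indeterminate-regular
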